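{- Let $X$ be a finite nonempty set of cardinality $n$ and let $N=\binom{n}{2}$. The number of different principal left ideals in $\mathcal{M}(X)$ is $$\sum_{d=1}^n\binom{n}{d}\sum_{k=0}^{N}\binom{N+n-d}{k}.$$
   Context: $\mathcal{M}(X)=X^{X\times X}$ is the set of all binary operations on $X$, a monoid under $\triangleright$ defined by $a(\circ\triangleright\ast)b=(a\circ b)\ast(b\circ a)$ for all $a,b\in X$, with identity $a\circ_{lz}b=a$. The principal left ideal generated by $\ast$ is $\{\circ\triangleright\ast : \circ\in\mathcal{M}(X)\}$. -}

module Defs where

open import Algebra.Bundles using (Monoid)
open import Algebra.Core using (Op₂)
open import Data.Fin.Base using (Fin)
open import Data.List.Base using (applyUpTo)
open import Data.Nat.Base using (ℕ; suc; _+_; _∸_)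
open import Data.Nat.ListAction using (sum)
open import Data.Product.Base using (∃-syntax; _,_; proj₁)
open import Function.Bundles using (Inverse)
open import Level using (Level; _⊔_) renaming (suc to lsuc)
open import Relation.Binary.Bundles using (Setoid)
import Relation.Binary.Construct.On as On
open import Relation.Binary.PropositionalEquality
  using (_≡_; refl; sym; trans; cong₂; setoid)
open import Relation.Unary using (Pred; _≐_)
open import Relation.Unary.Relation.Binary.Equality using (≐-setoid)

private
  variable
    a ℓ : Level

infixl 7 _▷_

_▷_ : {X : Set a} → Op₂ X → Op₂ X → Op₂ X
(_∘_ ▷ _∗_) x y = (x ∘ y) ∗ (y ∘ x)

lz : {X : Set a} → Op₂ X
lz x y = x

-- Without function extensionality, equality of operations has to be
-- taken pointwise.
𝓜 : Set a → Monoid a a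
𝓜 X = record
  { Carrier  = Op₂ X
  ; _≈_      = λ _∘_ _∗_ → ∀ x y → x ∘ y ≡ x ∗ y
  ; _∙_      = _▷_
  ; ε        = lz
  ; isMonoid = record
    { isSemigroup = record
      { isMagma = record
        { isEquivalence = record
          { refl  = λ x y → refl
          ; sym   = λ p x y → sym (p x y)
          ; trans = λ p q x y → trans (p x y) (q x y)
          }
        ; ∙-cong = λ {_} {_∘′_} {_∗_} p q x y →
            trans (cong₂ _∗_ (p x y) (p y x)) (q (x ∘′ y) (y ∘′ x))
        }
      ; assoc = λ _ _ _ x y → refl
      }
    ; identity = (λ _ x y → refl) , (λ _ x y → refl)
    }
  }

module _ (M : Monoid a ℓ) where
  open Monoid M using (Carrier; _≈_; _∙_)

  principalLeftIdeal : Carrier → Pred Carrier (a ⊔ ℓ)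
  principalLeftIdeal m x = ∃[ y ] x ≈ y ∙ m

  IsPrincipalLeftIdeal : Pred Carrier (a ⊔ ℓ) → Set (a ⊔ ℓ)
  IsPrincipalLeftIdeal I = ∃[ m ] I ≐ principalLeftIdeal m

  -- Ideals are compared as subsets; the chosen generator is irrelevant.
  principalLeftIdeals : Setoid (lsuc (a ⊔ ℓ)) (a ⊔ ℓ)
  principalLeftIdeals =
    On.setoid (≐-setoid Carrier (a ⊔ ℓ)) (proj₁ {B = IsPrincipalLeftIdeal})

HasCardinality : Setoid a ℓ → ℕ → Set (a ⊔ ℓ)
HasCardinality S n = Inverse S (setoid (Fin n))

-- Both bounds are inclusive.
sumFromTo : ℕ → ℕ → (ℕ → ℕ) → ℕ
sumFromTo m n f = sum (applyUpTo (λ i → f (m + i)) (suc n ∸ m))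

infix 5 sumFromTo
syntax sumFromTo m n (λ i → e) = ∑[ i from m to n ] e

{-# OPTIONS --safe #-}

-- An operation ∗ is the same thing as the map (x , y) ↦ (x ∗ y , y ∗ x) of
-- X × X, which commutes with swapping; ▷ is then composition. Such a map
-- factors through another one exactly when its images of the diagonal and of
-- X × X are contained in those of the other one (swap-fixed points have to be
-- lifted to swap-fixed points, all other points can be lifted freely). So an
-- ideal is given by the image D ≠ ∅ of the diagonal together with the set E of
-- swap-orbits in the image that do not come from D. Of the N + n orbits,
-- N + n ∸ |D| are candidates for E, and at most N are attained, because only
-- the N non-diagonal orbits can be mapped outside D.
module Submission where

open import Algebra.Bundles using (Monoid)
open import Algebra.Core using (Op₂)
open import Data.Empty using (⊥)
open import Data.Fin.Base
  using (Fin; zero; suc; toℕ; fromℕ<; _↑ˡ_; _↑ʳ_; splitAt)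
open import Data.Fin.Properties
  using (_≟_; any?; 0↔⊥; +↔⊎; *↔×; splitAt-↑ˡ; splitAt-↑ʳ;
         splitAt⁻¹-↑ˡ; splitAt⁻¹-↑ʳ; suc-injective; toℕ-injective;
         toℕ-fromℕ<; toℕ≤pred[n]; injective⇒≤)
open import Data.Fin.Subset
  using (Subset; Side; inside; outside; _∈_; _∉_; _⊆_; _∩_; ∁; ∣_∣; ⊤; Nonempty)
open import Data.Fin.Subset.Properties
  using (drop-there; drop-∷-⊆; _∈?_; ⊆-antisym; ⊆-reflexive; ⊆⊤; ∣⊤∣≡n;
         ∣p∣≤n; ∣∁p∣≡n∸∣p∣; x∈p⇒∣p-x∣<∣p∣; x∈∁p⇒x∉p; x∉p⇒x∈∁p;
         x∈p∩q⁺; x∈p∩q⁻; p∩q⊆q; ∈⊤; out⊆; in⊆in)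
open import Data.List.Base using (applyUpTo)
open import Data.Nat.Base
  using (ℕ; zero; suc; _+_; _*_; _∸_; _≤_; _<_; z≤n; s≤s)
open import Data.Nat.Combinatorics
  using (_C_; nC1≡n; nCk+nC[k+1]≡[n+1]C[k+1])
open import Data.Nat.ListAction using (sum)
open import Data.Nat.Properties
  using (≤-trans; ≤-<-trans; ≤-reflexive; +-∸-assoc)
  renaming (suc-injective to ℕ-suc-injective)
open import Data.Product.Base as Product
  using (Σ; Σ-syntax; ∃; ∃-syntax; _×_; _,_; proj₁; proj₂; swap)
open import Data.Product.Properties using (≡-dec; ,-injective)
open import Data.Product.Function.Dependent.Propositional using (Σ-↔)
open import Data.Sum.Base as Sum using (_⊎_; inj₁; inj₂; [_,_]′)
open import Data.Sum.Function.Propositional using (_⊎-↔_)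
open import Data.Vec.Base using ([]; _∷_; here; there; _++_; tabulate; tail)
open import Data.Vec.Properties
  using ([]=⇒lookup; lookup⇒[]=; lookup∘tabulate; lookup-++ˡ; lookup-++ʳ)
open import Function.Base using (_∘_; id; const)
open import Function.Bundles using (Inverse; _↔_; mk↔ₛ′)
import Function.Construct.Composition as Composition
open import Function.Definitions using (Injective)
open import Function.Properties.Inverse using (↔-refl; ↔-sym; ↔-trans)
open import Level using (Level)
open import Relation.Binary.PropositionalEquality
  using (_≡_; refl; sym; trans; cong; cong₂; subst; setoid;
         module ≡-Reasoning)
open import Relation.Nullary
  using (yes; no; does; contradiction)
open import Relation.Nullary.Decidable using (dec-true)
open import Relation.Unary using (Pred; Decidable; _≐_)
open import Defs

private
  variable
    a ℓ : Level
    A B : Set a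
    k l m n : ℕ
    s : Side
    p q : Subset n

-- Counting

Fin-cong : m ≡ n → Fin m ↔ Fin n
Fin-cong refl = ↔-refl

Fin-sum↔Σ : ∀ (f : ℕ → ℕ) m →
            Fin (sum (applyUpTo f m)) ↔ Σ (Fin m) (λ i → Fin (f (toℕ i)))
Fin-sum↔Σ f zero    = mk↔ₛ′ (λ ()) (λ ()) (λ ()) (λ ())
Fin-sum↔Σ f (suc m) =
  ↔-trans +↔⊎ (↔-trans (↔-refl ⊎-↔ Fin-sum↔Σ (f ∘ suc) m)
    (mk↔ₛ′ [ (zero ,_) , Product.map suc id ]′
           (λ { (zero , x) → inj₁ x ; (suc i , x) → inj₂ (i , x) })
           (λ { (zero , x) → refl ; (suc i , x) → refl })
           (λ { (inj₁ x) → refl ; (inj₂ x) → refl })))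

-- The `k`-element subsets of `p`, generated along Pascal's rule. No proofs of inclusion or size
-- take part in the equality of two choices.
data Choice : Subset n → ℕ → Set where
  []   : Choice [] 0
  skip : Choice p k → Choice (s ∷ p) k
  take : Choice p k → Choice (inside ∷ p) (suc k)

⟦_⟧ : {p : Subset n} → Choice p k → Subset n
⟦ []     ⟧ = []
⟦ skip c ⟧ = outside ∷ ⟦ c ⟧
⟦ take c ⟧ = inside ∷ ⟦ c ⟧

∣⟦⟧∣ : (c : Choice p k) → ∣ ⟦ c ⟧ ∣ ≡ k
∣⟦⟧∣ []       = refl
∣⟦⟧∣ (skip c) = ∣⟦⟧∣ c
∣⟦⟧∣ (take c) = cong suc (∣⟦⟧∣ c)

⟦⟧⊆ : (c : Choice p k) → ⟦ c ⟧ ⊆ p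
⟦⟧⊆ []       = id
⟦⟧⊆ (skip c) = out⊆ (⟦⟧⊆ c)
⟦⟧⊆ (take c) = in⊆in (⟦⟧⊆ c)

⟦⟧-injective : (c d : Choice p k) → ⟦ c ⟧ ≡ ⟦ d ⟧ → c ≡ d
⟦⟧-injective []       []       eq = refl
⟦⟧-injective (skip c) (skip d) eq = cong skip (⟦⟧-injective c d (cong tail eq))
⟦⟧-injective (take c) (take d) eq = cong take (⟦⟧-injective c d (cong tail eq))
⟦⟧-injective (skip c) (take d) ()
⟦⟧-injective (take c) (skip d) ()

choose : ∀ (p q : Subset n) → q ⊆ p → ∣ q ∣ ≡ k → ∃[ c ] ⟦_⟧ {k = k} {p} c ≡ q
choose []       []            q⊆p refl = [] , refl
choose (_ ∷ p)  (outside ∷ q) q⊆p eq   =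
  Product.map skip (cong (outside ∷_)) (choose p q (drop-there ∘ q⊆p ∘ there) eq)
-- The inclusion forces the head of the larger subset to be `inside`, as `take` requires.
choose (_ ∷ p)  (inside ∷ q)  q⊆p refl with here ← q⊆p here =
  Product.map take (cong (inside ∷_)) (choose p q (drop-∷-⊆ q⊆p) refl)

-- Pascal's rule at an `inside` head, which is either taken or skipped. An `outside` head, or any
-- head once `k` is zero, can only be skipped.
Fin↔Choice : ∀ (p : Subset n) k → Fin (∣ p ∣ C k) ↔ Choice p k
Fin↔Choice []            zero    =
  mk↔ₛ′ (const []) (const zero) (λ { [] → refl }) (λ { zero → refl })
Fin↔Choice []            (suc k) = mk↔ₛ′ (λ ()) (λ ()) (λ ()) (λ ())
Fin↔Choice (outside ∷ p) k       = ↔-trans (Fin↔Choice p k)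
  (mk↔ₛ′ skip (λ { (skip c) → c }) (λ { (skip c) → refl }) (λ _ → refl))
Fin↔Choice (inside ∷ p)  zero    = ↔-trans (Fin↔Choice p zero)
  (mk↔ₛ′ skip (λ { (skip c) → c }) (λ { (skip c) → refl }) (λ _ → refl))
Fin↔Choice (inside ∷ p)  (suc k) =
  ↔-trans (Fin-cong (sym (nCk+nC[k+1]≡[n+1]C[k+1] ∣ p ∣ k)))
    (↔-trans +↔⊎ (↔-trans (Fin↔Choice p k ⊎-↔ Fin↔Choice p (suc k))
      (mk↔ₛ′ [ take , skip ]′ (λ { (take c) → inj₁ c ; (skip c) → inj₂ c })
             (λ { (take c) → refl ; (skip c) → refl })
             (λ { (inj₁ c) → refl ; (inj₂ c) → refl }))))

-- Finite subsets

subset : {P : Pred (Fin n) ℓ} → Decidable P → Subset n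
subset P? = tabulate (does ∘ P?)

module _ {P : Pred (Fin n) ℓ} (P? : Decidable P) where

  ∈-subset⁺ : ∀ {x} → P x → x ∈ subset P?
  ∈-subset⁺ {x} px = lookup⇒[]= x _
    (trans (lookup∘tabulate (does ∘ P?) x) (dec-true (P? x) px))

  ∈-subset⁻ : ∀ {x} → x ∈ subset P? → P x
  ∈-subset⁻ {x} x∈ with P? x | trans (sym (lookup∘tabulate (does ∘ P?) x)) ([]=⇒lookup x∈)
  ... | yes px | _ = px

∈-++ˡ : ∀ {x} (q : Subset m) → x ∈ p → x ↑ˡ m ∈ p ++ q
∈-++ˡ {p = p} {x} q x∈p = lookup⇒[]= _ _ (trans (lookup-++ˡ p q x) ([]=⇒lookup x∈p))

∈-++ʳ : ∀ {x} (p : Subset m) → x ∈ q → m ↑ʳ x ∈ p ++ q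
∈-++ʳ {q = q} {x} p x∈q = lookup⇒[]= _ _ (trans (lookup-++ʳ p q x) ([]=⇒lookup x∈q))

∈-++ʳ⁻ : ∀ {x} (p : Subset m) → m ↑ʳ x ∈ p ++ q → x ∈ q
∈-++ʳ⁻ {q = q} {x} p x∈ = lookup⇒[]= _ _ (trans (sym (lookup-++ʳ p q x)) ([]=⇒lookup x∈))

∣++∣ : ∀ (p : Subset m) (q : Subset n) → ∣ p ++ q ∣ ≡ ∣ p ∣ + ∣ q ∣
∣++∣ []            q = refl
∣++∣ (outside ∷ p) q = ∣++∣ p q
∣++∣ (inside ∷ p)  q = cong suc (∣++∣ p q)

enumerate : (p : Subset n) → Fin ∣ p ∣ → Fin n
enumerate (outside ∷ p) i       = suc (enumerate p i)
enumerate (inside ∷ p)  zero    = zero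
enumerate (inside ∷ p)  (suc i) = suc (enumerate p i)

enumerate-∈ : ∀ (p : Subset n) i → enumerate p i ∈ p
enumerate-∈ (outside ∷ p) i       = there (enumerate-∈ p i)
enumerate-∈ (inside ∷ p)  zero    = here
enumerate-∈ (inside ∷ p)  (suc i) = there (enumerate-∈ p i)

enumerate-injective : ∀ (p : Subset n) → Injective _≡_ _≡_ (enumerate p)
enumerate-injective (outside ∷ p) eq = enumerate-injective p (suc-injective eq)
enumerate-injective (inside ∷ p) {zero}  {zero}  eq = refl
enumerate-injective (inside ∷ p) {suc i} {suc j} eq =
  cong suc (enumerate-injective p (suc-injective eq))

-- Choosing for each member of `p` an index that `g` sends to it is injective, since `g` undoes the
-- choice.
covered⇒∣p∣≤ : ∀ (p : Subset n) (g : Fin k → Fin n) →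
               (∀ {x} → x ∈ p → ∃[ i ] g i ≡ x) → ∣ p ∣ ≤ k
covered⇒∣p∣≤ p g cover = injective⇒≤ {f = section} λ {i} {j} eq →
  enumerate-injective p
    (trans (sym (proj₂ (cover (enumerate-∈ p i))))
      (trans (cong g eq) (proj₂ (cover (enumerate-∈ p j)))))
  where
  section : Fin ∣ p ∣ → Fin _
  section i = proj₁ (cover (enumerate-∈ p i))

-- The first `∣ p ∣` values of `g` list `f` on `p`, and `default` fills the remaining places. A
-- general `f` lets the induction pass to `f ∘ suc`.
∣p∣≤⇒covered : ∀ (p : Subset n) (f : Fin n → A) (default : A) → ∣ p ∣ ≤ k →
               Σ[ g ∈ (Fin k → A) ]
                 (∀ i → (∃[ x ] x ∈ p × g i ≡ f x) ⊎ g i ≡ default) ×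
                 (∀ {x} → x ∈ p → ∃[ i ] g i ≡ f x)
∣p∣≤⇒covered []            f default _ =
  const default , (λ _ → inj₂ refl) , λ ()
∣p∣≤⇒covered (outside ∷ p) f default ∣p∣≤k
  with g , values , covers ← ∣p∣≤⇒covered p (f ∘ suc) default ∣p∣≤k =
  g ,
  (λ i → Sum.map₁ (Product.map suc (Product.map₁ there)) (values i)) ,
  λ { (there x∈p) → covers x∈p }
∣p∣≤⇒covered (inside ∷ p)  f default (s≤s ∣p∣≤k)
  with g , values , covers ← ∣p∣≤⇒covered p (f ∘ suc) default ∣p∣≤k =
  (λ { zero → f zero ; (suc i) → g i }) ,
  (λ { zero    → inj₁ (zero , here , refl)
     ; (suc i) → Sum.map₁ (Product.map suc (Product.map₁ there)) (values i) }) ,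
  λ { here → zero , refl ; (there x∈p) → Product.map suc id (covers x∈p) }

Nonempty⇒∣p∣>0 : Nonempty p → 0 < ∣ p ∣
Nonempty⇒∣p∣>0 (x , x∈p) = ≤-<-trans z≤n (x∈p⇒∣p-x∣<∣p∣ x∈p)

∣p∣≡suc⇒Nonempty : ∀ (p : Subset n) → ∣ p ∣ ≡ suc k → Nonempty p
∣p∣≡suc⇒Nonempty p eq = _ , enumerate-∈ p (subst Fin (sym eq) zero)

-- Orbits of the swap

-- Unordered pairs of distinct elements: `inj₁ j` stands for `zero` and `suc j`, while `inj₂` shifts
-- a pair so that it avoids `zero`. This split is Pascal's rule for `suc n C 2`.
Pair : ℕ → Set
Pair zero    = ⊥
Pair (suc n) = Fin n ⊎ Pair n

Pair↔Fin : ∀ n → Pair n ↔ Fin (n C 2)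
Pair↔Fin zero    = ↔-sym 0↔⊥
Pair↔Fin (suc n) =
  ↔-trans (↔-trans (Fin-cong (sym (nC1≡n n))) ↔-refl ⊎-↔ Pair↔Fin n)
    (↔-trans (↔-sym +↔⊎) (Fin-cong (nCk+nC[k+1]≡[n+1]C[k+1] n 1)))

points : Pair n → Fin n × Fin n
points {suc n} (inj₁ j) = zero , suc j
points {suc n} (inj₂ p) = Product.map suc suc (points p)

representative : Pair n ⊎ Fin n → Fin n × Fin n
representative = [ points , (λ x → x , x) ]′

unordered : Fin n × Fin n → Pair n ⊎ Fin n
unordered (zero  , zero)  = inj₂ zero
unordered (zero  , suc j) = inj₁ (inj₁ j)
unordered (suc i , zero)  = inj₁ (inj₁ i)
unordered (suc i , suc j) = Sum.map inj₂ suc (unordered (i , j))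

unordered-swap : (z : Fin n × Fin n) → unordered (swap z) ≡ unordered z
unordered-swap (zero  , zero)  = refl
unordered-swap (zero  , suc j) = refl
unordered-swap (suc i , zero)  = refl
unordered-swap (suc i , suc j) = cong (Sum.map inj₂ suc) (unordered-swap (i , j))

unordered-diagonal : (x : Fin n) → unordered (x , x) ≡ inj₂ x
unordered-diagonal zero    = refl
unordered-diagonal (suc x) = cong (Sum.map inj₂ suc) (unordered-diagonal x)

unordered-representative : (u : Pair n ⊎ Fin n) → unordered (representative u) ≡ u
unordered-representative {suc n} (inj₁ (inj₁ j)) = refl
unordered-representative {suc n} (inj₁ (inj₂ p)) =
  cong (Sum.map inj₂ suc) (unordered-representative (inj₁ p))
unordered-representative (inj₂ x) = unordered-diagonal x

representative-map : (u : Pair n ⊎ Fin n) →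
  representative (Sum.map inj₂ suc u) ≡ Product.map suc suc (representative u)
representative-map (inj₁ p) = refl
representative-map (inj₂ x) = refl

-- An orbit is a point with its mirror image, and `points` picks the one whose first coordinate is
-- the smaller.
representative-unordered : (z : Fin n × Fin n) →
  representative (unordered z) ≡ z ⊎ representative (unordered z) ≡ swap z
representative-unordered (zero  , zero)  = inj₁ refl
representative-unordered (zero  , suc j) = inj₁ refl
representative-unordered (suc i , zero)  = inj₂ refl
representative-unordered (suc i , suc j) =
  Sum.map lift lift (representative-unordered (i , j))
  where
  lift : ∀ {z} → representative (unordered (i , j)) ≡ z → _ ≡ Product.map suc suc z
  lift eq = trans (representative-map (unordered (i , j))) (cong (Product.map suc suc) eq)

-- Operations as equivariant maps

⟪_⟫ : Op₂ A → A × A → A × A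
⟪ _∗_ ⟫ (x , y) = x ∗ y , y ∗ x

module _ {n : ℕ} where

  private
    N : ℕ
    N = n C 2

    Ideal : Op₂ (Fin n) → Pred (Op₂ (Fin n)) _
    Ideal = principalLeftIdeal (𝓜 (Fin n))

  orbit↔ : (Pair n ⊎ Fin n) ↔ Fin (N + n)
  orbit↔ = ↔-trans (Pair↔Fin n ⊎-↔ ↔-refl) (↔-sym +↔⊎)

  -- The n diagonal orbits come last: that of (x , x) is N ↑ʳ x.
  orbit : Fin n × Fin n → Fin (N + n)
  orbit z = Inverse.to orbit↔ (unordered z)

  point : Fin (N + n) → Fin n × Fin n
  point o = representative (Inverse.from orbit↔ o)

  orbit-swap : ∀ z → orbit (swap z) ≡ orbit z
  orbit-swap z = cong (Inverse.to orbit↔) (unordered-swap z)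

  orbit-point : ∀ o → orbit (point o) ≡ o
  orbit-point o = trans
    (cong (Inverse.to orbit↔) (unordered-representative (Inverse.from orbit↔ o)))
    (Inverse.strictlyInverseˡ orbit↔ o)

  orbit-diagonal : ∀ x → orbit (x , x) ≡ N ↑ʳ x
  orbit-diagonal x = cong (Inverse.to orbit↔) (unordered-diagonal x)

  point-orbit : ∀ z → point (orbit z) ≡ z ⊎ point (orbit z) ≡ swap z
  point-orbit z = subst
    (λ u → representative u ≡ z ⊎ representative u ≡ swap z)
    (sym (Inverse.strictlyInverseʳ orbit↔ (unordered z)))
    (representative-unordered z)

  point-diagonal : ∀ x → point (N ↑ʳ x) ≡ (x , x)
  point-diagonal x = trans (cong point (sym (orbit-diagonal x)))
    ([ id , id ]′ (point-orbit (x , x)))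

  -- Each point agrees up to swapping with the representative of the common orbit, and two swaps
  -- cancel.
  orbit-separates : ∀ z z′ → orbit z ≡ orbit z′ → z ≡ z′ ⊎ z ≡ swap z′
  orbit-separates z z′ eq with point-orbit z | point-orbit z′
  ... | inj₁ p | inj₁ q = inj₁ (trans (sym p) (trans (cong point eq) q))
  ... | inj₁ p | inj₂ q = inj₂ (trans (sym p) (trans (cong point eq) q))
  ... | inj₂ p | inj₁ q = inj₂ (cong swap (trans (sym p) (trans (cong point eq) q)))
  ... | inj₂ p | inj₂ q = inj₁ (cong swap (trans (sym p) (trans (cong point eq) q)))

  fixed⇒diagonal : ∀ o → swap (point o) ≡ point o → ∃[ x ] o ≡ N ↑ʳ x
  fixed⇒diagonal o fixed = proj₁ (point o) ,
    trans (sym (orbit-point o))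
      (trans (cong (orbit ∘ (proj₁ (point o) ,_)) (cong proj₁ fixed))
        (orbit-diagonal _))

  data OrbitView : Fin (N + n) → Set where
    offDiagonal : ∀ i → OrbitView (i ↑ˡ n)
    diagonal    : ∀ x → OrbitView (N ↑ʳ x)

  orbitView : ∀ o → OrbitView o
  orbitView o with splitAt N o in eq
  ... | inj₁ i = subst OrbitView (splitAt⁻¹-↑ˡ eq) (offDiagonal i)
  ... | inj₂ x = subst OrbitView (splitAt⁻¹-↑ʳ eq) (diagonal x)

  -- Operations prescribed on orbit representatives.

  module _ (h : Fin (N + n) → Fin n × Fin n)
           (h-fixed : ∀ o → swap (point o) ≡ point o → swap (h o) ≡ h o) where

    private
      -- Equivariance forces this: a representative receives the first coordinate of `h`, its mirror
      -- image the second.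
      value : Fin n × Fin n → Fin n
      value z with ≡-dec _≟_ _≟_ (point (orbit z)) z
      ... | yes _ = proj₁ (h (orbit z))
      ... | no  _ = proj₂ (h (orbit z))

      value-point : ∀ o → value (point o) ≡ proj₁ (h o)
      value-point o with ≡-dec _≟_ _≟_ (point (orbit (point o))) (point o)
      ... | yes _ = cong (proj₁ ∘ h) (orbit-point o)
      ... | no ≢o = contradiction (cong point (orbit-point o)) ≢o

      value-swap : ∀ o → value (swap (point o)) ≡ proj₂ (h o)
      value-swap o with ≡-dec _≟_ _≟_ (point (orbit (swap (point o)))) (swap (point o))
                      | trans (orbit-swap (point o)) (orbit-point o)
      -- Here the mirror image is itself the representative, so the point is fixed by swapping and
      -- `h-fixed` makes both coordinates of `h o` equal.
      ... | yes p | eq = trans (cong (proj₁ ∘ h) eq)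
        (cong proj₂ (h-fixed o (trans (sym p) (cong point eq))))
      ... | no _  | eq = cong (proj₂ ∘ h) eq

    extend : Op₂ (Fin n)
    extend x y = value (x , y)

    extend-point : ∀ o → ⟪ extend ⟫ (point o) ≡ h o
    extend-point o = cong₂ _,_ (value-point o) (value-swap o)

  -- The left factor is built from the lifts of the representatives alone and extended
  -- equivariantly, which the clause on fixed points makes possible.
  lifts⇒∈Ideal : ∀ (_∗_ _⋆_ : Op₂ (Fin n)) →
    (∀ z → ∃[ z′ ] ⟪ _⋆_ ⟫ z′ ≡ ⟪ _∗_ ⟫ z × (swap z ≡ z → swap z′ ≡ z′)) →
    Ideal _⋆_ _∗_
  lifts⇒∈Ideal _∗_ _⋆_ lifts = _∙_ , λ x y → cong proj₁ (everywhere (x , y))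
    where
    h : Fin (N + n) → Fin n × Fin n
    h = proj₁ ∘ lifts ∘ point

    h-fixed : ∀ o → swap (point o) ≡ point o → swap (h o) ≡ h o
    h-fixed o = proj₂ (proj₂ (lifts (point o)))

    _∙_ : Op₂ (Fin n)
    _∙_ = extend h h-fixed

    at-point : ∀ o → ⟪ _∗_ ⟫ (point o) ≡ ⟪ _⋆_ ⟫ (⟪ _∙_ ⟫ (point o))
    at-point o = sym (trans (cong ⟪ _⋆_ ⟫ (extend-point h h-fixed o))
                            (proj₁ (proj₂ (lifts (point o)))))

    everywhere : ∀ z → ⟪ _∗_ ⟫ z ≡ ⟪ _⋆_ ⟫ (⟪ _∙_ ⟫ z)
    everywhere z with point-orbit z | at-point (orbit z)
    ... | inj₁ eq | at = subst (λ z → ⟪ _∗_ ⟫ z ≡ ⟪ _⋆_ ⟫ (⟪ _∙_ ⟫ z)) eq at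
    -- `⟪_⟫` commutes with `swap` by computation, so the equation carries over to the mirror image.
    ... | inj₂ eq | at =
      cong swap (subst (λ z → ⟪ _∗_ ⟫ z ≡ ⟪ _⋆_ ⟫ (⟪ _∙_ ⟫ z)) eq at)

  -- The invariant of a principal left ideal

  diagonalImage? : ∀ (_∗_ : Op₂ (Fin n)) → Decidable (λ x → ∃[ a ] a ∗ a ≡ x)
  diagonalImage? _∗_ x = any? λ a → (a ∗ a) ≟ x

  diagonalImage : Op₂ (Fin n) → Subset n
  diagonalImage _∗_ = subset (diagonalImage? _∗_)

  image? : ∀ (_∗_ : Op₂ (Fin n)) →
           Decidable (λ o → ∃[ x ] ∃[ y ] orbit (⟪ _∗_ ⟫ (x , y)) ≡ o)
  image? _∗_ o = any? λ x → any? λ y → orbit (⟪ _∗_ ⟫ (x , y)) ≟ o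

  image : Op₂ (Fin n) → Subset (N + n)
  image _∗_ = subset (image? _∗_)

  -- The orbits other than those of `(x , x)` with `x` in `D`, in the order fixed by `orbit`.
  avoiding : Subset n → Subset (N + n)
  avoiding D = ⊤ {N} ++ ∁ D

  -- The diagonal orbits over the diagonal image lie in the image anyway. Once they are removed,
  -- what is left is restricted in size only by the bound `N`.
  newOrbits : Op₂ (Fin n) → Subset (N + n)
  newOrbits _∗_ = image _∗_ ∩ avoiding (diagonalImage _∗_)

  invariant : Op₂ (Fin n) → Subset n × Subset (N + n)
  invariant _∗_ = diagonalImage _∗_ , newOrbits _∗_

  diagonal∈avoiding⁻ : ∀ {x} D → N ↑ʳ x ∈ avoiding D → x ∉ D
  diagonal∈avoiding⁻ D x∈ = x∈∁p⇒x∉p (∈-++ʳ⁻ (⊤ {N}) x∈)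

  ∉avoiding⇒diagonal : ∀ {o} D → o ∉ avoiding D → ∃[ x ] o ≡ N ↑ʳ x × x ∈ D
  ∉avoiding⇒diagonal {o} D o∉ with orbitView o
  ... | offDiagonal i = contradiction (∈-++ˡ (∁ D) ∈⊤) o∉
  ... | diagonal x with x ∈? D
  ...   | yes x∈D = x , refl , x∈D
  ...   | no  x∉D = contradiction (∈-++ʳ (⊤ {N}) (x∉p⇒x∈∁p x∉D)) o∉

  ∈Ideal⇒diagonalImage⊆ : ∀ _∗_ _⋆_ → Ideal _⋆_ _∗_ →
                           diagonalImage _∗_ ⊆ diagonalImage _⋆_
  ∈Ideal⇒diagonalImage⊆ _∗_ _⋆_ (_∙_ , eq) x∈
    with a , refl ← ∈-subset⁻ (diagonalImage? _∗_) x∈ =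
    ∈-subset⁺ (diagonalImage? _⋆_) (a ∙ a , sym (eq a a))

  ∈Ideal⇒image⊆ : ∀ _∗_ _⋆_ → Ideal _⋆_ _∗_ → image _∗_ ⊆ image _⋆_
  ∈Ideal⇒image⊆ _∗_ _⋆_ (_∙_ , eq) o∈
    with x , y , refl ← ∈-subset⁻ (image? _∗_) o∈ =
    ∈-subset⁺ (image? _⋆_)
      (x ∙ y , y ∙ x , cong orbit (cong₂ _,_ (sym (eq x y)) (sym (eq y x))))

  -- Diagonal points are lifted through the diagonal images, so that they stay fixed by swapping;
  -- the others are lifted through the orbits in the image.
  ⊆⇒∈Ideal : ∀ _∗_ _⋆_ → diagonalImage _∗_ ⊆ diagonalImage _⋆_ →
             image _∗_ ⊆ image _⋆_ → Ideal _⋆_ _∗_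
  ⊆⇒∈Ideal _∗_ _⋆_ D⊆ I⊆ = lifts⇒∈Ideal _∗_ _⋆_ lifts
    where
    lifts : ∀ z → ∃[ z′ ] ⟪ _⋆_ ⟫ z′ ≡ ⟪ _∗_ ⟫ z × (swap z ≡ z → swap z′ ≡ z′)
    lifts (x , y) with x ≟ y
    ... | yes refl
      with a , eq ← ∈-subset⁻ (diagonalImage? _⋆_)
                      (D⊆ (∈-subset⁺ (diagonalImage? _∗_) (x , refl))) =
      (a , a) , cong₂ _,_ eq eq , const refl
    ... | no x≢y
      with u , v , eq ← ∈-subset⁻ (image? _⋆_)
                          (I⊆ (∈-subset⁺ (image? _∗_) (x , y , refl)))
      with orbit-separates _ _ eq
    -- Equal orbits agree only up to swapping, so the lift is `(u , v)` or `(v , u)`. As `x` and `y`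
    -- differ, the condition on fixed points is vacuous.
    ... | inj₁ eq′ = (u , v) , eq′ , λ fixed → contradiction (cong proj₂ fixed) x≢y
    ... | inj₂ eq′ = (v , u) , cong swap eq′ , λ fixed → contradiction (cong proj₂ fixed) x≢y

  diagonalImage⊆image : ∀ _∗_ {x} → x ∈ diagonalImage _∗_ → N ↑ʳ x ∈ image _∗_
  diagonalImage⊆image _∗_ x∈
    with a , refl ← ∈-subset⁻ (diagonalImage? _∗_) x∈ =
    ∈-subset⁺ (image? _∗_) (a , a , orbit-diagonal (a ∗ a))

  invariant-cong : ∀ _∗_ _⋆_ → Ideal _⋆_ _∗_ → Ideal _∗_ _⋆_ →
                   invariant _∗_ ≡ invariant _⋆_
  invariant-cong _∗_ _⋆_ ∗∈ ⋆∈ =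
    cong₂ _,_ D≡ (cong₂ (λ I D → I ∩ avoiding D) I≡ D≡)
    where
    D≡ : diagonalImage _∗_ ≡ diagonalImage _⋆_
    D≡ = ⊆-antisym (∈Ideal⇒diagonalImage⊆ _∗_ _⋆_ ∗∈)
                   (∈Ideal⇒diagonalImage⊆ _⋆_ _∗_ ⋆∈)
    I≡ : image _∗_ ≡ image _⋆_
    I≡ = ⊆-antisym (∈Ideal⇒image⊆ _∗_ _⋆_ ∗∈) (∈Ideal⇒image⊆ _⋆_ _∗_ ⋆∈)

  -- The image can be recovered from the invariant: an orbit in it is either new, or diagonal over
  -- the common diagonal image and thus in both images.
  invariant-injective : ∀ _∗_ _⋆_ → invariant _∗_ ≡ invariant _⋆_ → Ideal _⋆_ _∗_
  invariant-injective _∗_ _⋆_ eq = ⊆⇒∈Ideal _∗_ _⋆_ D⊆ I⊆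
    where
    D⊆ : diagonalImage _∗_ ⊆ diagonalImage _⋆_
    D⊆ = ⊆-reflexive (cong proj₁ eq)
    I⊆ : image _∗_ ⊆ image _⋆_
    I⊆ {o} o∈ with o ∈? avoiding (diagonalImage _∗_)
    ... | yes o∈A = proj₁ (x∈p∩q⁻ _ _ (⊆-reflexive (cong proj₂ eq) (x∈p∩q⁺ (o∈ , o∈A))))
    ... | no  o∉A with x , refl , x∈D ← ∉avoiding⇒diagonal (diagonalImage _∗_) o∉A =
      diagonalImage⊆image _⋆_ (D⊆ x∈D)

  -- A diagonal orbit is sent to a diagonal orbit over the diagonal image, which is not new. Hence
  -- new orbits come from the `N` off-diagonal ones, which bounds their number.
  newOrbit-source : ∀ _∗_ {o} → o ∈ newOrbits _∗_ →
                    ∃[ i ] orbit (⟪ _∗_ ⟫ (point (i ↑ˡ n))) ≡ o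
  newOrbit-source _∗_ {o} o∈ with x∈p∩q⁻ (image _∗_) _ o∈
  ... | o∈I , o∈A with x , y , eq ← ∈-subset⁻ (image? _∗_) o∈I
    with orbitView (orbit (x , y)) | at-point
    where
    at-point : orbit (⟪ _∗_ ⟫ (point (orbit (x , y)))) ≡ o
    at-point with point-orbit (x , y)
    ... | inj₁ p = trans (cong (orbit ∘ ⟪ _∗_ ⟫) p) eq
    ... | inj₂ p = trans (cong (orbit ∘ ⟪ _∗_ ⟫) p) (trans (orbit-swap (⟪ _∗_ ⟫ (x , y))) eq)
  ... | v | at = go v at
    where
    go : ∀ {o′} → OrbitView o′ → orbit (⟪ _∗_ ⟫ (point o′)) ≡ o →
         ∃[ i ] orbit (⟪ _∗_ ⟫ (point (i ↑ˡ n))) ≡ o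
    go (offDiagonal i) at = i , at
    go (diagonal x)    at = contradiction
      (∈-subset⁺ (diagonalImage? _∗_) (x , refl))
      (diagonal∈avoiding⁻ _ (subst (_∈ avoiding (diagonalImage _∗_)) o≡ o∈A))
      where
      o≡ : o ≡ N ↑ʳ (x ∗ x)
      o≡ = trans (sym at)
        (trans (cong (orbit ∘ ⟪ _∗_ ⟫) (point-diagonal x)) (orbit-diagonal (x ∗ x)))

  -- The values taken by the invariant.

  Admissible : Pred (Subset n × Subset (N + n)) _
  Admissible (D , E) = Nonempty D × E ⊆ avoiding D × ∣ E ∣ ≤ N

  invariant-admissible : Fin n → ∀ _∗_ → Admissible (invariant _∗_)
  invariant-admissible x _∗_ =
    (x ∗ x , ∈-subset⁺ (diagonalImage? _∗_) (x , refl)) ,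
    p∩q⊆q (image _∗_) _ ,
    covered⇒∣p∣≤ (newOrbits _∗_) _ (newOrbit-source _∗_)

  -- The diagonal is retracted onto `D`, and the `N` off-diagonal orbits suffice to cover `E`.
  realise : ∀ s → Admissible s → ∃[ m ] invariant m ≡ s
  realise (D , E) ((d , d∈D) , E⊆ , ∣E∣≤N)
    -- Surplus off-diagonal orbits go to the diagonal orbit of `d`, which is not new because `d`
    -- lies in `D`.
    with g , values , covers ← ∣p∣≤⇒covered E id (N ↑ʳ d) ∣E∣≤N =
    _∗_ , cong₂ _,_ D≡ (⊆-antisym E⊆⁻ E⊆⁺)
    where
    retract : Fin n → Fin n
    retract x with x ∈? D
    ... | yes _ = x
    ... | no  _ = d

    retract-∈ : ∀ x → retract x ∈ D
    retract-∈ x with x ∈? D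
    ... | yes x∈D = x∈D
    ... | no  _   = d∈D

    retract-fixes : ∀ {x} → x ∈ D → retract x ≡ x
    retract-fixes {x} x∈D with x ∈? D
    ... | yes _   = refl
    ... | no  x∉D = contradiction x∈D x∉D

    h : Fin (N + n) → Fin n × Fin n
    h o = [ point ∘ g , (λ x → retract x , retract x) ]′ (splitAt N o)

    h-diagonal : ∀ x → h (N ↑ʳ x) ≡ (retract x , retract x)
    h-diagonal x = cong [ point ∘ g , _ ]′ (splitAt-↑ʳ N n x)

    h-fixed : ∀ o → swap (point o) ≡ point o → swap (h o) ≡ h o
    h-fixed o fixed with x , refl ← fixed⇒diagonal o fixed =
      trans (cong swap (h-diagonal x)) (sym (h-diagonal x))

    _∗_ : Op₂ (Fin n)
    _∗_ = extend h h-fixed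

    ∗-diagonal : ∀ x → x ∗ x ≡ retract x
    ∗-diagonal x = cong proj₁
      (trans (cong ⟪ _∗_ ⟫ (sym (point-diagonal x)))
        (trans (extend-point h h-fixed (N ↑ʳ x)) (h-diagonal x)))

    ∗-offDiagonal : ∀ i → orbit (⟪ _∗_ ⟫ (point (i ↑ˡ n))) ≡ g i
    ∗-offDiagonal i = trans
      (cong orbit (trans (extend-point h h-fixed (i ↑ˡ n))
                         (cong [ point ∘ g , _ ]′ (splitAt-↑ˡ N i n))))
      (orbit-point (g i))

    D⊆⁻ : diagonalImage _∗_ ⊆ D
    D⊆⁻ x∈ with a , refl ← ∈-subset⁻ (diagonalImage? _∗_) x∈ =
      subst (_∈ D) (sym (∗-diagonal a)) (retract-∈ a)

    D⊆⁺ : D ⊆ diagonalImage _∗_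
    D⊆⁺ {x} x∈D = ∈-subset⁺ (diagonalImage? _∗_)
      (x , trans (∗-diagonal x) (retract-fixes x∈D))

    D≡ : diagonalImage _∗_ ≡ D
    D≡ = ⊆-antisym D⊆⁻ D⊆⁺

    E⊆⁻ : newOrbits _∗_ ⊆ E
    E⊆⁻ {o} o∈ = in-E (newOrbit-source _∗_ o∈)
      where
      in-E : ∃[ i ] orbit (⟪ _∗_ ⟫ (point (i ↑ˡ n))) ≡ o → o ∈ E
      in-E (i , eq) = [ old , new ]′ (values i)
        where
        gi≡o : g i ≡ o
        gi≡o = trans (sym (∗-offDiagonal i)) eq

        old : (∃[ o′ ] o′ ∈ E × g i ≡ o′) → o ∈ E
        old (o′ , o′∈E , gi≡o′) = subst (_∈ E) (trans (sym gi≡o′) gi≡o) o′∈E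

        -- The default orbit lies over `D`, whereas `o` is in `avoiding D`.
        new : g i ≡ N ↑ʳ d → o ∈ E
        new gi≡d = contradiction d∈D (diagonal∈avoiding⁻ D
          (subst (_∈ avoiding D) (trans (sym gi≡o) gi≡d)
            (subst (λ D → o ∈ avoiding D) D≡
              (p∩q⊆q (image _∗_) (avoiding (diagonalImage _∗_)) o∈))))

    E⊆⁺ : E ⊆ newOrbits _∗_
    E⊆⁺ {o} o∈E with i , refl ← covers o∈E = x∈p∩q⁺ {p = image _∗_} {avoiding (diagonalImage _∗_)}
      ( ∈-subset⁺ (image? _∗_)
          (proj₁ (point (i ↑ˡ n)) , proj₂ (point (i ↑ˡ n)) , ∗-offDiagonal i)
      , subst (λ D → o ∈ avoiding D) (sym D≡) (E⊆ o∈E))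

  -- Codes for admissible pairs

  -- The shape of the double sum: `suc (toℕ i)` is the size of `D`, which starts at 1, and `toℕ k`
  -- is the size of `E`, from 0 to `N` inclusive.
  Code : Set
  Code = Σ[ i ∈ Fin n ] Σ[ D ∈ Choice (⊤ {n}) (suc (toℕ i)) ]
         Σ[ k ∈ Fin (suc N) ] Choice (avoiding ⟦ D ⟧) (toℕ k)

  decode : Code → Subset n × Subset (N + n)
  decode (i , D , k , E) = ⟦ D ⟧ , ⟦ E ⟧

  decode-admissible : ∀ c → Admissible (decode c)
  decode-admissible (i , D , k , E) =
    ∣p∣≡suc⇒Nonempty ⟦ D ⟧ (∣⟦⟧∣ D) , ⟦⟧⊆ E ,
    ≤-trans (≤-reflexive (∣⟦⟧∣ E)) (toℕ≤pred[n] k)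

  encode : ∀ s → Admissible s → ∃[ c ] decode c ≡ s
  encode (D , E) (D≢∅ , E⊆ , ∣E∣≤N)
    with ∣ D ∣ in ∣D∣≡ | Nonempty⇒∣p∣>0 D≢∅ | ∣p∣≤n D
  -- Nonemptiness excludes size zero, and `suc d ≤ n` makes `d` an index in `Fin n`.
  ... | suc d | _ | d<n
    with choose ⊤ D ⊆⊤ (trans ∣D∣≡ (cong suc (sym (toℕ-fromℕ< d<n))))
  ... | D′ , refl
    with E′ , E′≡E ← choose (avoiding ⟦ D′ ⟧) E E⊆ (sym (toℕ-fromℕ< (s≤s ∣E∣≤N))) =
    (fromℕ< d<n , D′ , fromℕ< (s≤s ∣E∣≤N) , E′) , cong (⟦ D′ ⟧ ,_) E′≡E

  decode-injective : ∀ c c′ → decode c ≡ decode c′ → c ≡ c′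
  decode-injective (i , D , k , E) (i′ , D′ , k′ , E′) eq
    with ,-injective eq
  ... | D≡ , E≡
    -- The sizes are recovered from the subsets first; only then do the two choices have the same
    -- type.
    with refl ← toℕ-injective {i = i} {i′} (ℕ-suc-injective
                  (trans (sym (∣⟦⟧∣ D)) (trans (cong ∣_∣ D≡) (∣⟦⟧∣ D′))))
    with refl ← toℕ-injective {i = k} {k′}
                  (trans (sym (∣⟦⟧∣ E)) (trans (cong ∣_∣ E≡) (∣⟦⟧∣ E′)))
    with refl ← ⟦⟧-injective D D′ D≡
    with refl ← ⟦⟧-injective E E′ E≡ = refl

  ∣avoiding∣ : ∀ D → ∣ avoiding D ∣ ≡ N + n ∸ ∣ D ∣
  ∣avoiding∣ D = begin
    ∣ ⊤ {N} ++ ∁ D ∣     ≡⟨ ∣++∣ (⊤ {N}) (∁ D) ⟩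
    ∣ ⊤ {N} ∣ + ∣ ∁ D ∣  ≡⟨ cong₂ _+_ (∣⊤∣≡n N) (∣∁p∣≡n∸∣p∣ D) ⟩
    N + (n ∸ ∣ D ∣)      ≡⟨ +-∸-assoc N (∣p∣≤n D) ⟨
    N + n ∸ ∣ D ∣        ∎
    where open ≡-Reasoning

  -- The number of choices for `E` depends on `D` only through its size, which yields the product
  -- with `n C d`.
  Fin↔Code :
    Fin (∑[ d from 1 to n ] ((n C d) * (∑[ k from 0 to N ] ((N + n ∸ d) C k)))) ↔ Code
  Fin↔Code =
    ↔-trans (Fin-sum↔Σ _ n) (Σ-↔ ↔-refl (λ {i} → ↔-trans *↔× (Σ-↔ Fin↔D (λ {j} →
      ↔-trans (Fin-sum↔Σ (λ k → (N + n ∸ suc (toℕ i)) C k) (suc N))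
        (Σ-↔ ↔-refl (λ {k} → Fin↔E (Inverse.to Fin↔D j) (toℕ k)))))))
    where
    Fin↔D : Fin (n C l) ↔ Choice (⊤ {n}) l
    Fin↔D {l} = ↔-trans (Fin-cong (cong (_C l) (sym (∣⊤∣≡n n)))) (Fin↔Choice ⊤ l)

    Fin↔E : (D : Choice (⊤ {n}) l) → ∀ k →
            Fin ((N + n ∸ l) C k) ↔ Choice (avoiding ⟦ D ⟧) k
    Fin↔E D k = ↔-trans
      (Fin-cong (cong (_C k)
        (trans (cong (N + n ∸_) (sym (∣⟦⟧∣ D))) (sym (∣avoiding∣ ⟦ D ⟧)))))
      (Fin↔Choice (avoiding ⟦ D ⟧) k)

-- Transfer along a bijection

module _ (X↔Y : A ↔ B) where
  open Inverse X↔Y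

  conjugate : Op₂ A → Op₂ B
  conjugate _∗_ x y = to (from x ∗ from y)

  conjugate-∈ : ∀ _∗_ _⋆_ → principalLeftIdeal (𝓜 A) _⋆_ _∗_ →
                principalLeftIdeal (𝓜 B) (conjugate _⋆_) (conjugate _∗_)
  conjugate-∈ _∗_ _⋆_ (_∙_ , eq) = conjugate _∙_ , λ x y → cong to
    (trans (eq (from x) (from y))
      (cong₂ _⋆_ (sym (strictlyInverseʳ _)) (sym (strictlyInverseʳ _))))

  conjugate-∈⁻ : ∀ _∗_ _⋆_ →
                 principalLeftIdeal (𝓜 B) (conjugate _⋆_) (conjugate _∗_) →
                 principalLeftIdeal (𝓜 A) _⋆_ _∗_
  conjugate-∈⁻ _∗_ _⋆_ (_∙_ , eq) = (λ x y → from (to x ∙ to y)) , λ x y → begin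
    x ∗ y
      ≡⟨ cong₂ _∗_ (strictlyInverseʳ x) (strictlyInverseʳ y) ⟨
    from (to x) ∗ from (to y)
      ≡⟨ strictlyInverseʳ _ ⟨
    from (conjugate _∗_ (to x) (to y))
      ≡⟨ cong from (eq (to x) (to y)) ⟩
    from (to (from (to x ∙ to y) ⋆ from (to y ∙ to x)))
      ≡⟨ strictlyInverseʳ _ ⟩
    from (to x ∙ to y) ⋆ from (to y ∙ to x) ∎
    where open ≡-Reasoning

  conjugate-from : ∀ (_∗_ : Op₂ B) x y → to (from (to (from x) ∗ to (from y))) ≡ x ∗ y
  conjugate-from _∗_ x y = trans (strictlyInverseˡ _)
    (cong₂ _∗_ (strictlyInverseˡ x) (strictlyInverseˡ y))

-- Principal left ideals classified by an invariant.

module _ (M : Monoid a ℓ) where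
  open Monoid M using (Carrier; _≈_; _∙_; ∙-congˡ; assoc; identityˡ)
    renaming (refl to ≈-refl; sym to ≈-sym; trans to ≈-trans)

  ≈⇒∈ : ∀ {x y} → x ≈ y → principalLeftIdeal M y x
  ≈⇒∈ x≈y = _ , ≈-trans x≈y (≈-sym (identityˡ _))

  ∈-trans : ∀ {x y z} → principalLeftIdeal M y x → principalLeftIdeal M z y →
            principalLeftIdeal M z x
  ∈-trans (u , x≈uy) (v , y≈vz) =
    u ∙ v , ≈-trans x≈uy (≈-trans (∙-congˡ y≈vz) (≈-sym (assoc u v _)))

  -- Two elements generate the same ideal exactly when each lies in the ideal of the other. So `inv`
  -- separates the ideals, and the codes, being in bijection with its values, count them.
  classification :
    (inv : Carrier → A) →
    (∀ x y → principalLeftIdeal M y x → principalLeftIdeal M x y → inv x ≡ inv y) →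
    (∀ x y → inv x ≡ inv y → principalLeftIdeal M y x) →
    (decode : B → A) → Injective _≡_ _≡_ decode →
    (∀ x → ∃[ c ] decode c ≡ inv x) →
    (∀ c → ∃[ x ] inv x ≡ decode c) →
    Inverse (principalLeftIdeals M) (setoid B)
  classification inv inv-cong inv-injective decode decode-injective code rep = record
    { to        = λ (I , x , _) → proj₁ (code x)
    ; from      = λ c → _ , proj₁ (rep c) , id , id
    ; to-cong   = λ {I} {J} → to-cong {I} {J}
    ; from-cong = λ { refl → id , id }
    ; inverse   =
        (λ {c} {J} J≐ → decode-injective
          (trans (proj₂ (code _)) (trans
            (generators-inv J (_ , proj₁ (rep c) , id , id) J≐) (proj₂ (rep c)))))
      -- The generator `x` and the representative of its code have equal invariants, so each lies in
      -- the ideal of the other.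
      , (λ { {I , x , I⊆ , ⊆I} {c} refl →
             let eq = trans (proj₂ (rep (proj₁ (code x)))) (proj₂ (code x)) in
             (λ y∈ → ⊆I (∈-trans y∈ (inv-injective _ _ eq)))
           , (λ y∈ → ∈-trans (I⊆ y∈) (inv-injective _ _ (sym eq))) })
    }
    where
    Ideals : Set _
    Ideals = ∃ (IsPrincipalLeftIdeal M)

    -- Each generator lies in its own ideal, hence in the equal ideal generated by the other.
    generators-inv : ((I , x , _) (J , y , _) : Ideals) → I ≐ J → inv x ≡ inv y
    generators-inv (I , x , I⊆ , ⊆I) (J , y , J⊆ , ⊆J) (I⊆J , J⊆I) =
      inv-cong x y (J⊆ (I⊆J (⊆I (≈⇒∈ ≈-refl)))) (I⊆ (J⊆I (⊆J (≈⇒∈ ≈-refl))))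

    to-cong : {(I , x , _) (J , y , _) : Ideals} → I ≐ J → proj₁ (code x) ≡ proj₁ (code y)
    to-cong {I} {J} I≐J = decode-injective
      (trans (proj₂ (code _)) (trans (generators-inv I J I≐J) (sym (proj₂ (code _)))))

theorem7 : ∀ {a : Level} (X : Set a) (n : ℕ) → X → HasCardinality (setoid X) n →
    let N = n C 2 in
    HasCardinality (principalLeftIdeals (𝓜 X))
    (∑[ d from 1 to n ] ((n C d) * (∑[ k from 0 to N ] ((N + n ∸ d) C k))))
theorem7 X n x X↔Fin = Composition.inverse
  (classification (𝓜 X) (invariant ∘ conj)
    (λ _∗_ _⋆_ ∗∈ ⋆∈ → invariant-cong _ _
      (conjugate-∈ X↔Fin _∗_ _⋆_ ∗∈) (conjugate-∈ X↔Fin _⋆_ _∗_ ⋆∈))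
    (λ _∗_ _⋆_ eq →
      conjugate-∈⁻ X↔Fin _∗_ _⋆_ (invariant-injective (conj _∗_) (conj _⋆_) eq))
    decode (decode-injective _ _)
    (λ _∗_ → encode _ (invariant-admissible (Inverse.to X↔Fin x) (conj _∗_)))
    λ c → let _∗_ , eq = realise _ (decode-admissible c) in
      conjugate (↔-sym X↔Fin) _∗_ ,
      -- Conjugating to `X` and back returns the operation only up to pointwise equality; the ideal,
      -- and with it the invariant, stays the same.
      trans (invariant-cong _ _
               (≈⇒∈ (𝓜 (Fin n)) (conjugate-from X↔Fin _∗_))
               (≈⇒∈ (𝓜 (Fin n)) (λ y z → sym (conjugate-from X↔Fin _∗_ y z))))
            eq)
  (↔-sym Fin↔Code)
  where
  conj : Op₂ X → Op₂ (Fin n)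
  conj = conjugate X↔Fin
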